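{- Let $n>5$ be an integer and let $K=\{123,321\}\{213,231\}$. There are exactly $3$ equivalence classes of $S_n$ under $K$-equivalence.
   Context: Permutations in $S_n$ are written as words $\pi_1\pi_2\cdots\pi_n$ in one-line notation. The order permutation of a word $u$ of $c$ distinct positive integers is the unique $\sigma\in S_c$ with $\sigma_i<\sigma_j$ iff $u_i<u_j$. A replacement partition $K$ of $S_c$ is a set partition of $S_c$; it is denoted by listing its parts with the one-element parts (and outer brackets) omitted, so here $K$ is the set partition of $S_3$ whose only parts of size greater than one are $\{123,321\}$ and $\{213,231\}$. The $K$-equivalence on $S_n$ is the equivalence relation generated by: $\phi\equiv\psi$ whenever $\phi=aub$ and $\psi=avb$ (concatenations) for some possibly empty words $a,b$ and words $u,v$ of length $c$ (so $u,v$ occupy the same $c$ consecutive positions) such that the order permutations of $u$ and $v$ lie in the same part of $K$. All equivalence classes are counted, including one-element classes. -}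

module Defs where

open import Data.Nat.Base using (ℕ; suc; _<_)
open import Data.Fin.Base using (Fin)
open import Data.Fin.Properties using (≡-setoid)
open import Data.List.Base using (List; []; _∷_; _++_; map; upTo)
open import Data.List.Membership.Propositional using (_∈_)
open import Data.List.Relation.Binary.Disjoint.Propositional using (Disjoint)
open import Data.List.Relation.Binary.Permutation.Propositional
  using (_↭_; ↭-refl; ↭-prep; ↭-swap; ↭-trans)
open import Data.List.Relation.Unary.All using (All; []; _∷_)
open import Data.List.Relation.Unary.AllPairs using (AllPairs; []; _∷_)
open import Data.List.Relation.Unary.Any using (Any; here; there)
open import Data.Product.Base using (_×_; _,_)
open import Data.Sum.Base using (_⊎_)
open import Data.Vec.Base using (Vec; []; _∷_; lookup; toList)
open import Function.Bundles using (_⇔_; Bijection)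
open import Level using (0ℓ)
open import Relation.Binary.Bundles using (Setoid)
open import Relation.Binary.Core using (Rel)
open import Relation.Binary.PropositionalEquality using (_≡_; refl)
import Relation.Binary.Construct.Closure.Equivalence as EqC
import Relation.Binary.Construct.On as On

IsPermutation : ∀ {n} → Vec ℕ n → Set
IsPermutation {n} w = toList w ↭ map suc (upTo n)

record S (n : ℕ) : Set where
  constructor perm
  field
    word          : Vec ℕ n
    isPermutation : IsPermutation word

open S public

IsOrderPermutation : ∀ {c} → Vec ℕ c → Vec ℕ c → Set
IsOrderPermutation {c} u σ =
  IsPermutation σ ×
  (∀ (i j : Fin c) → lookup σ i < lookup σ j ⇔ lookup u i < lookup u j)

-- A set partition of S_c, given by some of its parts; every permutation
-- not occurring in `parts` forms a part by itself.
record ReplacementPartition (c : ℕ) : Set where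
  field
    parts        : List (List (Vec ℕ c))
    permutations : All (All IsPermutation) parts
    disjoint     : AllPairs Disjoint parts

open ReplacementPartition public

SamePart : ∀ {c} → ReplacementPartition c → Rel (Vec ℕ c) 0ℓ
SamePart K σ τ = σ ≡ τ ⊎ Any (λ P → σ ∈ P × τ ∈ P) (parts K)

record Replacement {c} (K : ReplacementPartition c) {n : ℕ}
                   (φ ψ : Vec ℕ n) : Set where
  field
    φ-perm  : IsPermutation φ
    ψ-perm  : IsPermutation ψ
    a b     : List ℕ
    u v     : Vec ℕ c
    φ≡aub   : toList φ ≡ a ++ toList u ++ b
    ψ≡avb   : toList ψ ≡ a ++ toList v ++ b
    σ τ     : Vec ℕ c
    u-order : IsOrderPermutation u σ
    v-order : IsOrderPermutation v τ
    same    : SamePart K σ τ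

-- The closure is taken on words rather than on S n so that reflexivity
-- does not compare the proofs of IsPermutation.  All words in a chain of
-- replacements are permutations by φ-perm and ψ-perm.
equivalence : ∀ {c} → ReplacementPartition c → ℕ → Setoid 0ℓ 0ℓ
equivalence K n = On.setoid {B = S n} (EqC.setoid (Replacement K {n})) word

-- Injectivity and surjectivity of a Bijection are with respect to setoid
-- equality, so this counts equivalence classes.
HasExactlyClasses : Setoid 0ℓ 0ℓ → ℕ → Set
HasExactlyClasses A k = Bijection (≡-setoid k) A

K : ReplacementPartition 3
K = record
  { parts        = (p123 ∷ p321 ∷ []) ∷ (p213 ∷ p231 ∷ []) ∷ []
  ; permutations =
      (↭-refl ∷ ↭-trans (↭-swap 3 2 ↭-refl)
                 (↭-trans (↭-prep 2 (↭-swap 3 1 ↭-refl)) (↭-swap 2 1 ↭-refl)) ∷ [])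
    ∷ (↭-swap 2 1 ↭-refl ∷
       ↭-trans (↭-prep 2 (↭-swap 3 1 ↭-refl)) (↭-swap 2 1 ↭-refl) ∷ [])
    ∷ []
  ; disjoint     =
      ((λ { (here refl         , here ())
          ; (here refl         , there (here ()))
          ; (there (here refl) , here ())
          ; (there (here refl) , there (here ())) }) ∷ []) ∷ [] ∷ []
  }
  where
  p123 p321 p213 p231 : Vec ℕ 3
  p123 = 1 ∷ 2 ∷ 3 ∷ []
  p321 = 3 ∷ 2 ∷ 1 ∷ []
  p213 = 2 ∷ 1 ∷ 3 ∷ []
  p231 = 2 ∷ 3 ∷ 1 ∷ []

{-# OPTIONS --safe #-}
module Submission where

-- On a window of three consecutive letters a replacement either reverses a
-- monotone triple (123 <-> 321) or, when the first letter is the median,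
-- exchanges the other two (213 <-> 231).  Hence a triple can be rewritten
-- exactly when its third letter is not its median, and a word admits no
-- rewriting at all exactly when the third letter of every window is the
-- median.  Such words are the two "spirals" 1 n 2 (n-1) ... and
-- n 1 (n-1) 2 ..., which begin with an extreme letter, continue with the
-- opposite extreme of the remaining letters, and so on (`classify`,
-- `spiral-unique`).  Each spiral is a class by itself, and it remains to show
-- that for n at least 6 all the other words, the movable ones, are equivalent
-- (`movable-connected`).
--
-- This is proved by induction on the number of letters, for words on any set
-- of distinct letters.  For six letters it is a finite search: relabelling
-- the letters by an increasing map reduces to the letters 0, ..., 5, and the
-- component of 012345 is computed to contain all 720 words but the two
-- spirals (`six-letters`).
--
-- For the inductive step, a movable word is equivalent to one of the form
-- x u with u movable (`movable⇒start`): if the tail of the word is a spiral,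
-- then the first window is movable, so the word without its last letter is
-- movable and by induction can be rearranged to have a movable tail.  Two
-- words x u and x v with u and v movable are equivalent by induction.  If y
-- lies strictly between x and z, then reversing x y z in a word x y z r with
-- r movable changes the first letter from x to z (`hop`).  If no letter lies
-- between x and z, then among three other letters two lie on the same side
-- of both x and z; with y the nearer and t the farther of the two, the first
-- letter can be changed from x to t and from t to z, each time across y
-- (`two-hops`, `pigeonhole`).

open import Defs
open import Data.Nat.Base using (ℕ; zero; suc; _+_; _≤_; _<_; _>_; z≤n; s≤s)
open import Data.Nat.Properties
  using ( _≟_; _<?_; <-cmp; <-trans; <-asym; <-irrefl; <⇒≤; ≤-refl; ≤∧≢⇒<; n<1+n
        ; m≤m+n; m≤n⇒m<n∨m≡n; suc-injective; +-suc; +-identityʳ; ≤-decTotalOrder )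
open import Data.Fin.Base using (Fin)
open import Data.Fin.Patterns using (0F; 1F; 2F)
open import Data.List.Base
  using (List; []; _∷_; _++_; _∷ʳ_; map; concatMap; upTo; applyUpTo; length; initLast; _∷ʳ′_)
open import Data.List.Properties using (≡-dec; map-upTo; length-map; length-upTo)
open import Data.List.Membership.DecPropositional (≡-dec _≟_) using (_∈?_)
open import Data.List.Membership.Propositional using (_∈_; find)
open import Data.List.Membership.Propositional.Properties
  using (∈-map⁺; ∈-concatMap⁺; ∈-∃++; ∈-++⁺ˡ)
open import Data.List.Relation.Binary.Permutation.Propositional
  using (_↭_; ↭-refl; ↭-sym; ↭-trans; ↭-prep; ↭-swap; ↭-isEquivalence; ↭⇒↭ₛ)
open import Data.List.Relation.Binary.Permutation.Propositional.Properties as ↭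
  using ( All-resp-↭; ∈-resp-↭; ↭-length; ↭-map-inv; ↭-empty-inv; drop-∷; drop-mid
        ; shift; ++-comm )
import Data.List.Relation.Binary.Permutation.Setoid.Properties as ↭ₛ
open import Data.List.Relation.Unary.All as All using (All; []; _∷_; all?)
import Data.List.Relation.Unary.All.Properties as All
open import Data.List.Relation.Unary.AllPairs as AllPairs using ([]; _∷_)
open import Data.List.Relation.Unary.Any as Any using (here; there)
open import Data.List.Relation.Unary.Linked using (Linked; []; [-]; _∷_)
open import Data.List.Relation.Unary.Unique.Propositional using (Unique)
import Data.List.Relation.Unary.Unique.Propositional.Properties as Unique
open import Data.List.Sort ≤-decTotalOrder using (sort; sort-↭; sort-↗)
open import Data.Product.Base using (_×_; _,_; ∃; ∃₂; proj₁; proj₂; swap)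
open import Data.Sum.Base as Sum using (_⊎_; inj₁; inj₂)
open import Data.Vec.Base using (Vec; []; _∷_; lookup; toList; fromList)
import Data.Vec.Properties as Vec
open import Function.Base using (_∘_)
open import Function.Bundles using (_⇔_; mk⇔; Equivalence)
open import Level using (0ℓ)
open import Relation.Binary.Construct.Closure.Equivalence as EqC using (EqClosure)
open import Relation.Binary.Construct.Closure.ReflexiveTransitive using (ε; _◅_; _◅◅_)
open import Relation.Binary.Construct.Closure.Symmetric as Sym using (SymClosure; fwd; bwd)
open import Relation.Binary.Core using (Rel)
open import Relation.Binary.Definitions using (tri<; tri≈; tri>; Asymmetric)
open import Relation.Binary.PropositionalEquality
  using (_≡_; _≢_; refl; sym; trans; cong; subst; setoid)
open import Relation.Binary.Structures using (IsEquivalence)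
open import Relation.Nullary using (Dec; yes; no; ¬_; contradiction)
open import Relation.Nullary.Decidable using (_×-dec_; _⊎-dec_; toWitness)
open Equivalence using (to; from)

infix 4 _⇝_ _⇌_ _∼_ _≈_

-- Elementary moves

-- Replacement of one window, on words over arbitrary natural numbers and in
-- the two directions 123 -> 321 and 213 -> 231 only.
data _⇝_ : List ℕ → List ℕ → Set where
  reversal : ∀ {x y z w} → x < y → y < z → x ∷ y ∷ z ∷ w ⇝ z ∷ y ∷ x ∷ w
  rotation : ∀ {x y z w} → x < y → y < z → y ∷ x ∷ z ∷ w ⇝ y ∷ z ∷ x ∷ w
  skip     : ∀ {x u v} → u ⇝ v → x ∷ u ⇝ x ∷ v

_⇌_ : List ℕ → List ℕ → Set
_⇌_ = SymClosure _⇝_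

_∼_ : List ℕ → List ℕ → Set
_∼_ = EqClosure _⇝_

∼-sym : ∀ {u v} → u ∼ v → v ∼ u
∼-sym = EqC.symmetric _⇝_

∼-∷ : ∀ {x u v} → u ∼ v → x ∷ u ∼ x ∷ v
∼-∷ = EqC.gmap (_ ∷_) skip

⇝-∷ʳ : ∀ {u v} y → u ⇝ v → u ∷ʳ y ⇝ v ∷ʳ y
⇝-∷ʳ y (reversal p q) = reversal p q
⇝-∷ʳ y (rotation p q) = rotation p q
⇝-∷ʳ y (skip s)       = skip (⇝-∷ʳ y s)

∼-∷ʳ : ∀ {u v} y → u ∼ v → u ∷ʳ y ∼ v ∷ʳ y
∼-∷ʳ y = EqC.gmap (_∷ʳ y) (⇝-∷ʳ y)

⇝⇒↭ : ∀ {u v} → u ⇝ v → u ↭ v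
⇝⇒↭ (reversal {x} {y} {z} _ _) =
  ↭-trans (↭-prep x (↭-swap y z ↭-refl))
  (↭-trans (↭-swap x z ↭-refl) (↭-prep z (↭-swap x y ↭-refl)))
⇝⇒↭ (rotation {x} {y} {z} _ _) = ↭-prep y (↭-swap x z ↭-refl)
⇝⇒↭ (skip s) = ↭-prep _ (⇝⇒↭ s)

∼⇒↭ : ∀ {u v} → u ∼ v → u ↭ v
∼⇒↭ = EqC.fold ↭-isEquivalence ⇝⇒↭

Unique-↭ : ∀ {u v : List ℕ} → u ↭ v → Unique u → Unique v
Unique-↭ p = ↭ₛ.Unique-resp-↭ (setoid ℕ) (↭⇒↭ₛ p)

-- A word is movable if some window of it can be replaced, in either direction.
Movable : List ℕ → Set
Movable w = ∃ (w ⇌_)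

Movable-∷ : ∀ {w} x → Movable w → Movable (x ∷ w)
Movable-∷ x (_ , s) = _ , Sym.gmap (x ∷_) skip s

Movable-∷ʳ : ∀ {w} y → Movable w → Movable (w ∷ʳ y)
Movable-∷ʳ y (_ , s) = _ , Sym.gmap (_∷ʳ y) (⇝-∷ʳ y) s

-- Only the letters of a window decide whether it can be replaced, so a move
-- in the first window survives any change of the rest of the word.
Movable-∷⁻ : ∀ {x y z w} → Movable (x ∷ y ∷ z ∷ w) →
             (∀ w′ → Movable (x ∷ y ∷ z ∷ w′)) ⊎ Movable (y ∷ z ∷ w)
Movable-∷⁻ (_ , fwd (reversal p q)) = inj₁ λ _ → _ , fwd (reversal p q)
Movable-∷⁻ (_ , bwd (reversal p q)) = inj₁ λ _ → _ , bwd (reversal p q)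
Movable-∷⁻ (_ , fwd (rotation p q)) = inj₁ λ _ → _ , fwd (rotation p q)
Movable-∷⁻ (_ , bwd (rotation p q)) = inj₁ λ _ → _ , bwd (rotation p q)
Movable-∷⁻ (_ , fwd (skip s))       = inj₂ (_ , fwd s)
Movable-∷⁻ (_ , bwd (skip s))       = inj₂ (_ , bwd s)

-- Immovable words

-- `Spiral R S w`: the first letter of w is R-related to all later letters, the
-- second one is S-related to all later letters, and so on, R and S alternating.
data Spiral (R S : Rel ℕ 0ℓ) : List ℕ → Set where
  []  : Spiral R S []
  _∷_ : ∀ {x w} → All (R x) w → Spiral S R w → Spiral R S (x ∷ w)

-- The spirals beginning with their smallest, respectively largest, letter.
Low High : List ℕ → Set
Low  = Spiral _<_ _>_
High = Spiral _>_ _<_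

spiral-unique : ∀ {R S} → Asymmetric R → Asymmetric S →
                ∀ {u v} → Spiral R S u → Spiral R S v → u ↭ v → u ≡ v
spiral-unique ra sa []      []      p = refl
spiral-unique ra sa []      (_ ∷ _) p = contradiction (↭-sym p) ↭.¬x∷xs↭[]
spiral-unique ra sa (_ ∷ _) []      p = contradiction p ↭.¬x∷xs↭[]
spiral-unique ra sa (_∷_ {x} Rx s) (_∷_ {y} Ry t) p with x ≟ y
... | yes refl = cong (x ∷_) (spiral-unique sa ra s t (drop-∷ p))
... | no x≢y
  with ∈-resp-↭ p (here refl) | ∈-resp-↭ (↭-sym p) (here refl)
... | here x≡y  | _         = contradiction x≡y x≢y
... | there _   | here y≡x  = contradiction (sym y≡x) x≢y
... | there x∈v | there y∈u =
  contradiction (All.lookup Ry x∈v) (ra (All.lookup Rx y∈u))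

low-immovable  : ∀ {w} → Low w → ¬ Movable w
high-immovable : ∀ {w} → High w → ¬ Movable w
low-immovable ((_ ∷ x<z ∷ _) ∷ (y>z ∷ _) ∷ _) (_ , fwd (reversal _ q)) = <-asym q y>z
low-immovable ((z<y ∷ z<x ∷ _) ∷ _) (_ , bwd (reversal p q)) = <-asym q z<y
low-immovable ((x<y ∷ _) ∷ _) (_ , fwd (rotation p _)) = <-asym p x<y
low-immovable ((_ ∷ x<z ∷ _) ∷ _) (_ , bwd (rotation p _)) = <-asym p x<z
low-immovable (_ ∷ h) (_ , fwd (skip s)) = high-immovable h (_ , fwd s)
low-immovable (_ ∷ h) (_ , bwd (skip s)) = high-immovable h (_ , bwd s)
high-immovable ((x>y ∷ _) ∷ _) (_ , fwd (reversal p _)) = <-asym p x>y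
high-immovable (_ ∷ (y<x ∷ _) ∷ _) (_ , bwd (reversal p _)) = <-asym p y<x
high-immovable ((_ ∷ y>z ∷ _) ∷ _) (_ , fwd (rotation _ q)) = <-asym q y>z
high-immovable ((y>z ∷ _) ∷ _) (_ , bwd (rotation _ q)) = <-asym q y>z
high-immovable (_ ∷ l) (_ , fwd (skip s)) = low-immovable l (_ , fwd s)
high-immovable (_ ∷ l) (_ , bwd (skip s)) = low-immovable l (_ , bwd s)

-- If the tail of x y z ... is a spiral, then all letters after z lie between y
-- and z.  So x extends the spiral as soon as z separates x from y, and
-- otherwise z is not the median of x, y, z.
classify : ∀ {w} → Unique w → Low w ⊎ High w ⊎ Movable w
classify {[]} _ = inj₁ []
classify {x ∷ []} _ = inj₁ ([] ∷ [])
classify {x ∷ y ∷ w} ((x≢y ∷ x≢w) ∷ uw) with classify uw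
... | inj₂ (inj₂ m) = inj₂ (inj₂ (Movable-∷ x m))
classify {x ∷ y ∷ []} ((x≢y ∷ x≢w) ∷ uw) | inj₁ _ with <-cmp x y
... | tri< x<y _ _ = inj₁ ((x<y ∷ []) ∷ [] ∷ [])
... | tri≈ _ x≡y _ = contradiction x≡y x≢y
... | tri> _ _ x>y = inj₂ (inj₁ ((x>y ∷ []) ∷ [] ∷ []))
classify {x ∷ y ∷ []} ((x≢y ∷ x≢w) ∷ uw) | inj₂ (inj₁ _) with <-cmp x y
... | tri< x<y _ _ = inj₁ ((x<y ∷ []) ∷ [] ∷ [])
... | tri≈ _ x≡y _ = contradiction x≡y x≢y
... | tri> _ _ x>y = inj₂ (inj₁ ((x>y ∷ []) ∷ [] ∷ []))
classify {x ∷ y ∷ z ∷ w} ((x≢y ∷ x≢z ∷ _) ∷ uw)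
  | inj₁ l@((y<z ∷ _) ∷ (z>w ∷ _)) with <-cmp x z | <-cmp x y
... | tri≈ _ x≡z _ | _            = contradiction x≡z x≢z
... | _            | tri≈ _ x≡y _ = contradiction x≡y x≢y
... | tri< x<z _ _ | tri< x<y _ _ = inj₂ (inj₂ (_ , fwd (reversal x<y y<z)))
... | tri< x<z _ _ | tri> _ _ y<x = inj₂ (inj₂ (_ , fwd (rotation y<x x<z)))
... | tri> _ _ z<x | _            = inj₂ (inj₁ (
  (<-trans y<z z<x ∷ z<x ∷ All.map (λ p → <-trans p z<x) z>w) ∷ l))
classify {x ∷ y ∷ z ∷ w} ((x≢y ∷ x≢z ∷ _) ∷ uw)
  | inj₂ (inj₁ h@((y>z ∷ _) ∷ (z<w ∷ _))) with <-cmp x z | <-cmp x y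
... | tri≈ _ x≡z _ | _            = contradiction x≡z x≢z
... | _            | tri≈ _ x≡y _ = contradiction x≡y x≢y
... | tri> _ _ z<x | tri> _ _ y<x = inj₂ (inj₂ (_ , bwd (reversal y>z y<x)))
... | tri> _ _ z<x | tri< x<y _ _ = inj₂ (inj₂ (_ , bwd (rotation z<x x<y)))
... | tri< x<z _ _ | _            = inj₁ (
  (<-trans x<z y>z ∷ x<z ∷ All.map (<-trans x<z) z<w) ∷ h)

-- The letters a, a + 1, ..., a + k - 1.
interval : ℕ → ℕ → List ℕ
interval a zero    = []
interval a (suc k) = a ∷ interval (suc a) k

interval≡applyUpTo : ∀ {f : ℕ → ℕ} {a} → (∀ i → f i ≡ a + i) →
                     ∀ k → applyUpTo f k ≡ interval a k
interval≡applyUpTo         eq zero    = refl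
interval≡applyUpTo {f} {a} eq (suc k)
  rewrite trans (eq 0) (+-identityʳ a) =
  cong (a ∷_) (interval≡applyUpTo (λ i → trans (eq (suc i)) (+-suc a i)) k)

interval-last : ∀ a k → interval a (suc k) ↭ a + k ∷ interval a k
interval-last a zero    rewrite +-identityʳ a = ↭-refl
interval-last a (suc k) rewrite +-suc a k =
  ↭-trans (↭-prep a (interval-last (suc a) k)) (↭-swap a (suc a + k) ↭-refl)

interval-≥ : ∀ a k → All (a ≤_) (interval a k)
interval-≥ a zero    = []
interval-≥ a (suc k) = ≤-refl ∷ All.map <⇒≤ (interval-≥ (suc a) k)

interval-< : ∀ a k → All (_< a + k) (interval a k)
interval-< a zero    = []
interval-< a (suc k) rewrite +-suc a k = s≤s (m≤m+n a k) ∷ interval-< (suc a) k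

-- The two spirals on `interval a k`.
low high : ℕ → ℕ → List ℕ
low  a zero    = []
low  a (suc k) = a ∷ high (suc a) k
high a zero    = []
high a (suc k) = a + k ∷ low a k

low-↭  : ∀ a k → low  a k ↭ interval a k
high-↭ : ∀ a k → high a k ↭ interval a k
low-↭  a zero    = ↭-refl
low-↭  a (suc k) = ↭-prep a (high-↭ (suc a) k)
high-↭ a zero    = ↭-refl
high-↭ a (suc k) = ↭-trans (↭-prep (a + k) (low-↭ a k)) (↭-sym (interval-last a k))

low-spiral  : ∀ a k → Low  (low  a k)
high-spiral : ∀ a k → High (high a k)
low-spiral  a zero    = []
low-spiral  a (suc k) =
  All-resp-↭ (↭-sym (high-↭ (suc a) k)) (interval-≥ (suc a) k) ∷ high-spiral (suc a) k
high-spiral a zero    = []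
high-spiral a (suc k) =
  All-resp-↭ (↭-sym (low-↭ a k)) (interval-< a k) ∷ low-spiral a k

-- Enumeration of the rearrangements of a word

insertions : ℕ → List ℕ → List (List ℕ)
insertions x []       = (x ∷ []) ∷ []
insertions x (y ∷ ys) = (x ∷ y ∷ ys) ∷ map (y ∷_) (insertions x ys)

permutationsOf : List ℕ → List (List ℕ)
permutationsOf []       = [] ∷ []
permutationsOf (x ∷ xs) = concatMap (insertions x) (permutationsOf xs)

∈-insertions : ∀ x us vs → us ++ x ∷ vs ∈ insertions x (us ++ vs)
∈-insertions x []       []      = here refl
∈-insertions x []       (_ ∷ _) = here refl
∈-insertions x (u ∷ us) vs      = there (∈-map⁺ (u ∷_) (∈-insertions x us vs))

↭⇒∈-permutationsOf : ∀ {u} w → u ↭ w → u ∈ permutationsOf w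
↭⇒∈-permutationsOf []      p rewrite ↭-empty-inv p = here refl
↭⇒∈-permutationsOf (x ∷ w) p
  with us , vs , refl ← ∈-∃++ (∈-resp-↭ (↭-sym p) (here refl)) =
  ∈-concatMap⁺ (insertions x)
    (Any.map (λ { refl → ∈-insertions x us vs })
             (↭⇒∈-permutationsOf w (drop-mid us [] p)))

-- Words with six letters

when : ∀ {P : Set} → Dec P → List ℕ → List (List ℕ)
when (yes _) v = v ∷ []
when (no _)  v = []

-- All words obtained from a given one by one move in either direction.
neighbours : List ℕ → List (List ℕ)
neighbours (x ∷ y ∷ z ∷ w) =
  when (x <? y ×-dec y <? z) (z ∷ y ∷ x ∷ w) ++
  when (z <? y ×-dec y <? x) (z ∷ y ∷ x ∷ w) ++
  when (y <? x ×-dec x <? z) (x ∷ z ∷ y ∷ w) ++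
  when (z <? x ×-dec x <? y) (x ∷ z ∷ y ∷ w) ++
  map (x ∷_) (neighbours (y ∷ z ∷ w))
neighbours _ = []

neighbours-sound : ∀ w → All (w ⇌_) (neighbours w)
neighbours-sound []           = []
neighbours-sound (_ ∷ [])     = []
neighbours-sound (_ ∷ _ ∷ []) = []
neighbours-sound (x ∷ y ∷ z ∷ w) =
  All.++⁺ (when-sound (x <? y ×-dec y <? z) (λ (p , q) → fwd (reversal p q))) (
  All.++⁺ (when-sound (z <? y ×-dec y <? x) (λ (p , q) → bwd (reversal p q))) (
  All.++⁺ (when-sound (y <? x ×-dec x <? z) (λ (p , q) → fwd (rotation p q))) (
  All.++⁺ (when-sound (z <? x ×-dec x <? y) (λ (p , q) → bwd (rotation p q)))
      (All.map⁺ (All.map (Sym.gmap (x ∷_) skip) (neighbours-sound (y ∷ z ∷ w)))))))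
  where
  when-sound : ∀ {P : Set} {u v} (P? : Dec P) → (P → u ⇌ v) → All (u ⇌_) (when P? v)
  when-sound (yes p) f = f p ∷ []
  when-sound (no _)  f = []

-- Graph search: the words visited after k steps, starting from the visited
-- words `seen` with the words `todo` still to be visited.
explore : ℕ → List (List ℕ) → List (List ℕ) → List (List ℕ)
explore zero    seen _       = seen
explore (suc k) seen []      = seen
explore (suc k) seen (w ∷ ws) with w ∈? seen
... | yes _ = explore k seen ws
... | no _  = explore k (w ∷ seen) (neighbours w ++ ws)

explore-sound : ∀ {c} k {seen todo} → All (c ∼_) seen → All (c ∼_) todo →
                All (c ∼_) (explore k seen todo)
explore-sound zero    p q = p
explore-sound (suc k) p [] = p
explore-sound (suc k) {seen} {w ∷ _} p (c∼w ∷ q) with w ∈? seen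
... | yes _ = explore-sound k p q
... | no _  = explore-sound k (c∼w ∷ p)
                (All.++⁺ (All.map (λ s → c∼w ◅◅ s ◅ ε) (neighbours-sound w)) q)

-- The words found by k steps of the search from c.
component : ℕ → List ℕ → List (List ℕ)
component k c = explore k [] (c ∷ [])

component-sound : ∀ k {c u} → u ∈ component k c → c ∼ u
component-sound k = All.lookup (explore-sound k [] (ε ∷ []))

-- Evaluating the search on all 720 words decides the claim.  The component has
-- 718 words with 1920 neighbours in total, counted with multiplicity, so 2000
-- steps exhaust it.  The proof is abstract so that no later conversion
-- check runs the search again.
abstract
  six-letters : ∀ {u} → u ↭ upTo 6 → upTo 6 ∼ u ⊎ u ≡ low 0 6 ⊎ u ≡ high 0 6
  six-letters p =
    Sum.map₁ (component-sound 2000) (All.lookup allCovered (↭⇒∈-permutationsOf (upTo 6) p))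
    where
    Covered : List (List ℕ) → List ℕ → Set
    Covered ws u = u ∈ ws ⊎ u ≡ low 0 6 ⊎ u ≡ high 0 6

    covered? : ∀ ws us → Dec (All (Covered ws) us)
    covered? ws = all? λ u →
      u ∈? ws ⊎-dec ≡-dec _≟_ u (low 0 6) ⊎-dec ≡-dec _≟_ u (high 0 6)

    allCovered : All (Covered (component 2000 (upTo 6))) (permutationsOf (upTo 6))
    allCovered = toWitness {a? = covered? (component 2000 (upTo 6)) (permutationsOf (upTo 6))} _

-- Strictly increasing maps; these preserve moves and spirals.
Monotone : (ℕ → ℕ) → Set
Monotone f = ∀ {i j} → i < j → f i < f j

⇝-map : ∀ {f} → Monotone f → ∀ {u v} → u ⇝ v → map f u ⇝ map f v
⇝-map f↑ (reversal p q) = reversal (f↑ p) (f↑ q)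
⇝-map f↑ (rotation p q) = rotation (f↑ p) (f↑ q)
⇝-map f↑ (skip s)       = skip (⇝-map f↑ s)

Spiral-map : ∀ {R S f} → (∀ {i j} → R i j → R (f i) (f j)) →
             (∀ {i j} → S i j → S (f i) (f j)) →
             ∀ {w} → Spiral R S w → Spiral R S (map f w)
Spiral-map r s []      = []
Spiral-map r s (p ∷ q) = All.map⁺ (All.map r p) ∷ Spiral-map s r q

-- A strictly increasing list x ∷ xs continued to an increasing sequence.
extend : ℕ → List ℕ → ℕ → ℕ
extend x _        zero    = x
extend x []       (suc k) = suc (extend x [] k)
extend _ (y ∷ ys) (suc k) = extend y ys k

extend-step : ∀ {x xs} → Linked _<_ (x ∷ xs) → ∀ k → extend x xs k < extend x xs (suc k)
extend-step [-]      k       = n<1+n _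
extend-step (p ∷ _)  zero    = p
extend-step (_ ∷ ps) (suc k) = extend-step ps k

step⇒monotone : ∀ {f} → (∀ k → f k < f (suc k)) → Monotone f
step⇒monotone {f} st {i} {suc j} (s≤s i≤j) with m≤n⇒m<n∨m≡n i≤j
... | inj₁ i<j  = <-trans (step⇒monotone {f} st i<j) (st j)
... | inj₂ refl = st i

extend-lists : ∀ x xs → applyUpTo (extend x xs) (suc (length xs)) ≡ x ∷ xs
extend-lists x []       = refl
extend-lists x (y ∷ ys) = cong (x ∷_) (extend-lists y ys)

sort-< : ∀ {w} → Unique w → Linked _<_ (sort w)
sort-< {w} uw = strict (sort-↗ w) (Unique-↭ (↭-sym (sort-↭ w)) uw)
  where
  strict : ∀ {v} → Linked _≤_ v → Unique v → Linked _<_ v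
  strict []       _                 = []
  strict [-]      _                 = [-]
  strict (p ∷ ps) ((x≢y ∷ _) ∷ ys) = ≤∧≢⇒< p x≢y ∷ strict ps ys

-- Movable rearrangements of n distinct letters are equivalent.
Connected : ℕ → Set
Connected n = ∀ {u v} → length u ≡ n → Unique u → u ↭ v → Movable u → Movable v → u ∼ v

monotone-listing : ∀ {w n} → Linked _<_ w → length w ≡ suc n →
                   ∃ λ f → Monotone f × w ≡ map f (upTo (suc n))
monotone-listing {x ∷ xs} inc refl =
  extend x xs , step⇒monotone (extend-step inc) ,
  sym (trans (map-upTo (extend x xs) (suc (length xs))) (extend-lists x xs))

connected-6 : Connected 6
connected-6 {u} {v} len uu u↭v mu mv
  with f , f↑ , eq ← monotone-listing (sort-< uu) (trans (↭-length (sort-↭ u)) len) =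
  ∼-sym (to-sorted u-sorts mu) ◅◅ to-sorted (↭-trans u-sorts u↭v) mv
  where
  u-sorts : map f (upTo 6) ↭ u
  u-sorts = subst (_↭ u) eq (sort-↭ u)

  to-sorted : ∀ {w} → map f (upTo 6) ↭ w → Movable w → map f (upTo 6) ∼ w
  to-sorted p m with ↭-map-inv f p
  ... | w′ , refl , q with six-letters (↭-sym q)
  ... | inj₁ c∼w′ = EqC.gmap (map f) (⇝-map f↑) c∼w′
  ... | inj₂ (inj₁ refl) =
    contradiction m (low-immovable (Spiral-map f↑ f↑ (low-spiral 0 6)))
  ... | inj₂ (inj₂ refl) =
    contradiction m (high-immovable (Spiral-map f↑ f↑ (high-spiral 0 6)))

-- Induction on the number of letters

-- The increasing arrangement is movable.
movable-arrangement : ∀ {w k} → length w ≡ 3 + k → Unique w → ∃ λ w′ → w ↭ w′ × Movable w′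
movable-arrangement {w} len uw =
  sort w , ↭-sym (sort-↭ w) ,
  increasing (sort-< uw) (trans (↭-length (sort-↭ w)) len)
  where
  increasing : ∀ {v k} → Linked _<_ v → length v ≡ 3 + k → Movable v
  increasing (p ∷ q ∷ _) _ = _ , fwd (reversal p q)

-- y lies strictly between x and z.
Between : ℕ → ℕ → ℕ → Set
Between x y z = (x < y × y < z) ⊎ (z < y × y < x)

Between-sym : ∀ {x y z} → Between x y z → Between z y x
Between-sym = Sum.swap

-- The inductive step, for the rearrangements of a fixed word L of 7 + k
-- distinct letters.
module Step {k : ℕ} (connected : Connected (6 + k))
            {L : List ℕ} (len : length L ≡ 7 + k) (uL : Unique L) where

  -- Rearrangements of L with first letter x and movable tail.
  data Start (x : ℕ) : List ℕ → Set where
    start : ∀ {u} → L ↭ x ∷ u → Movable u → Start x (x ∷ u)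

  same-start : ∀ {x u v} → Start x u → Start x v → u ∼ v
  same-start (start p mu) (start q mv) =
    ∼-∷ (connected (suc-injective (trans (sym (↭-length p)) len))
                   (AllPairs.tail (Unique-↭ p uL))
                   (drop-∷ (↭-trans (↭-sym p) q)) mu mv)

  hop : ∀ {x y z r u v} → L ↭ x ∷ y ∷ z ∷ r → Between x y z →
        Start x u → Start z v → u ∼ v
  hop {x} {y} {z} {r} p b su sv
    with (_ ∷ _ ∷ _ ∷ ur) ← Unique-↭ p uL
    with r′ , r↭r′ , m ← movable-arrangement
           (suc-injective (suc-injective (suc-injective (trans (sym (↭-length p)) len))))
           ur =
    same-start su (start p′ (Movable-∷ y (Movable-∷ z m))) ◅◅ move b ◅◅
    same-start (start (↭-trans p′ (∼⇒↭ (move b))) (Movable-∷ y (Movable-∷ x m))) sv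
    where
    p′ : L ↭ x ∷ y ∷ z ∷ r′
    p′ = ↭-trans p (↭-prep x (↭-prep y (↭-prep z r↭r′)))
    move : Between x y z → x ∷ y ∷ z ∷ r′ ∼ z ∷ y ∷ x ∷ r′
    move (inj₁ (s , t)) = fwd (reversal s t) ◅ ε
    move (inj₂ (s , t)) = bwd (reversal s t) ◅ ε

  some-start : ∀ {x r} → L ↭ x ∷ r → ∃ (Start x)
  some-start p
    with (_ ∷ ur) ← Unique-↭ p uL
    with r′ , r↭r′ , m ← movable-arrangement (suc-injective (trans (sym (↭-length p)) len)) ur =
    _ , start (↭-trans p (↭-prep _ r↭r′)) m

  -- Changes the first letter from x to z by way of t, crossing y both times.
  two-hops : ∀ {x z y t r u v} → L ↭ x ∷ z ∷ y ∷ t ∷ r →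
             Between x y t → Between z y t →
             Start x u → Start z v → u ∼ v
  two-hops {x} {z} {y} {t} {r} p b c su sv =
    hop pˣ b su (proj₂ st) ◅◅ hop pᶻ (Between-sym c) (proj₂ st) sv
    where
    pˣ : L ↭ x ∷ y ∷ t ∷ z ∷ r
    pˣ = ↭-trans p (↭-prep x (↭-sym (shift z (y ∷ t ∷ []) r)))
    pᶻ : L ↭ t ∷ y ∷ z ∷ x ∷ r
    pᶻ = ↭-trans pˣ (↭-trans (↭-sym (shift x (y ∷ t ∷ z ∷ []) r)) (↭-swap y t ↭-refl))
    st = some-start pᶻ

  -- Position of y relative to the two letters x and z.
  data Side (x z y : ℕ) : Set where
    between : Between x y z → Side x z y
    above   : x < y → z < y → Side x z y
    below   : y < x → y < z → Side x z y

  side : ∀ x z y → x ≢ y → z ≢ y → Side x z y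
  side x z y x≢y z≢y with <-cmp x y | <-cmp z y
  ... | tri≈ _ x≡y _ | _            = contradiction x≡y x≢y
  ... | _            | tri≈ _ z≡y _ = contradiction z≡y z≢y
  ... | tri< x<y _ _ | tri< z<y _ _ = above x<y z<y
  ... | tri< x<y _ _ | tri> _ _ y<z = between (inj₁ (x<y , y<z))
  ... | tri> _ _ y<x | tri< z<y _ _ = between (inj₂ (z<y , y<x))
  ... | tri> _ _ y<x | tri> _ _ y<z = below y<x y<z

  both-above : ∀ {x z a b r u v} → L ↭ x ∷ z ∷ a ∷ b ∷ r → a ≢ b →
               x < a → z < a → x < b → z < b → Start x u → Start z v → u ∼ v
  both-above {x} {z} {a} {b} p a≢b xa za xb zb with <-cmp a b
  ... | tri< ab _ _  = two-hops p (inj₁ (xa , ab)) (inj₁ (za , ab))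
  ... | tri≈ _ a≡b _ = contradiction a≡b a≢b
  ... | tri> _ _ ba  = two-hops (↭-trans p (↭-prep x (↭-prep z (↭-swap a b ↭-refl))))
                                (inj₁ (xb , ba)) (inj₁ (zb , ba))

  both-below : ∀ {x z a b r u v} → L ↭ x ∷ z ∷ a ∷ b ∷ r → a ≢ b →
               a < x → a < z → b < x → b < z → Start x u → Start z v → u ∼ v
  both-below {x} {z} {a} {b} p a≢b ax az bx bz with <-cmp a b
  ... | tri> _ _ ba  = two-hops p (inj₂ (ba , ax)) (inj₂ (ba , az))
  ... | tri≈ _ a≡b _ = contradiction a≡b a≢b
  ... | tri< ab _ _  = two-hops (↭-trans p (↭-prep x (↭-prep z (↭-swap a b ↭-refl))))
                                (inj₂ (ab , bx)) (inj₂ (ab , bz))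

  pigeonhole : ∀ {x z u v} r → L ↭ x ∷ z ∷ r → length (x ∷ z ∷ r) ≡ 7 + k →
               Start x u → Start z v → u ∼ v
  pigeonhole {x} {z} (a ∷ b ∷ c ∷ r) p _
    with ((_ ∷ x≢a ∷ x≢b ∷ x≢c ∷ _) ∷ (z≢a ∷ z≢b ∷ z≢c ∷ _) ∷
          (a≢b ∷ a≢c ∷ _) ∷ (b≢c ∷ _) ∷ _) ← Unique-↭ p uL
    with side x z a x≢a z≢a | side x z b x≢b z≢b | side x z c x≢c z≢c
  ... | between i | _ | _ = hop (↭-trans p (↭-prep x (↭-swap z a ↭-refl))) i
  ... | _ | between i | _ = hop (↭-trans p (↭-prep x (shift b (z ∷ a ∷ []) (c ∷ r)))) i
  ... | _ | _ | between i = hop (↭-trans p (↭-prep x (shift c (z ∷ a ∷ b ∷ []) r))) i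
  ... | above xa za | above xb zb | _ = both-above p a≢b xa za xb zb
  ... | below ax az | below bx bz | _ = both-below p a≢b ax az bx bz
  ... | above xa za | _ | above xc zc =
    both-above (↭-trans p (↭-prep x (↭-prep z (↭-prep a (↭-swap b c ↭-refl))))) a≢c xa za xc zc
  ... | below ax az | _ | below cx cz =
    both-below (↭-trans p (↭-prep x (↭-prep z (↭-prep a (↭-swap b c ↭-refl))))) a≢c ax az cx cz
  ... | _ | above xb zb | above xc zc =
    both-above (↭-trans p (↭-prep x (↭-prep z (↭-sym (shift a (b ∷ c ∷ []) r))))) b≢c xb zb xc zc
  ... | _ | below bx bz | below cx cz =
    both-below (↭-trans p (↭-prep x (↭-prep z (↭-sym (shift a (b ∷ c ∷ []) r))))) b≢c bx bz cx cz

  different-start : ∀ {x z u v} → x ≢ z → Start x u → Start z v → u ∼ v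
  different-start {x} {z} x≢z su@(start p _) sv@(start q _)
    with ∈-resp-↭ (↭-trans (↭-sym q) p) (here refl)
  ... | here z≡x  = contradiction (sym z≡x) x≢z
  ... | there z∈u with us , vs , refl ← ∈-∃++ z∈u =
    pigeonhole (us ++ vs) p′ (trans (sym (↭-length p′)) len) su sv
    where
    p′ : L ↭ x ∷ z ∷ us ++ vs
    p′ = ↭-trans p (↭-prep x (shift z us vs))

  -- If the move is in the first window, then dropping the last letter t keeps
  -- the word movable, and the induction hypothesis applies to what is left.
  movable⇒start : ∀ {w} → L ↭ w → Movable w → ∃₂ λ x w′ → Start x w′ × w ∼ w′
  movable⇒start {[]} p _ with () ← trans (sym len) (↭-length p)
  movable⇒start {_ ∷ []} p _ with () ← trans (sym len) (↭-length p)
  movable⇒start {_ ∷ _ ∷ []} p _ with () ← trans (sym len) (↭-length p)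
  movable⇒start {x ∷ y ∷ z ∷ w} p m with Movable-∷⁻ m
  ... | inj₂ m′ = x , _ , start p m′ , ε
  ... | inj₁ f with initLast w
  ...   | [] with () ← trans (sym len) (↭-length p)
  ...   | w′ ∷ʳ′ t = x , _ , start (↭-trans p (∼⇒↭ w∼)) (Movable-∷ʳ t m″) , w∼
    where
    p′ : L ↭ t ∷ x ∷ y ∷ z ∷ w′
    p′ = ↭-trans p (↭-sym (↭.∷↭∷ʳ t (x ∷ y ∷ z ∷ w′)))
    len′ : length (x ∷ y ∷ z ∷ w′) ≡ 6 + k
    len′ = suc-injective (trans (sym (↭-length p′)) len)
    u′ : Unique (x ∷ y ∷ z ∷ w′)
    u′ = AllPairs.tail (Unique-↭ p′ uL)
    arr = movable-arrangement (suc-injective len′) (AllPairs.tail u′)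
    m″ : Movable (proj₁ arr)
    m″ = proj₂ (proj₂ arr)
    w∼ : x ∷ y ∷ z ∷ w′ ∷ʳ t ∼ x ∷ proj₁ arr ∷ʳ t
    w∼ = ∼-∷ʳ t (connected len′ u′ (↭-prep x (proj₁ (proj₂ arr))) (f w′) (Movable-∷ x m″))

  connected-suc : ∀ {v} → L ↭ v → Movable L → Movable v → L ∼ v
  connected-suc p mL mv
    with x , _ , su , e ← movable⇒start ↭-refl mL
       | z , _ , sv , f ← movable⇒start p mv
    with x ≟ z
  ... | yes refl = e ◅◅ same-start su sv ◅◅ ∼-sym f
  ... | no x≢z   = e ◅◅ different-start x≢z su sv ◅◅ ∼-sym f

movable-connected : ∀ k → Connected (6 + k)
movable-connected zero    = connected-6
movable-connected (suc k) len uu = Step.connected-suc (movable-connected k) len uu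

-- Replacements and elementary moves

letters-unique : ∀ {n} {w : List ℕ} → w ↭ map suc (upTo n) → Unique w
letters-unique {n} p = Unique-↭ (↭-sym p) (Unique.map⁺ suc-injective (Unique.upTo⁺ n))

toList-injective : ∀ {n} {φ ψ : Vec ℕ n} → toList φ ≡ toList ψ → φ ≡ ψ
toList-injective {φ = φ} {ψ} eq =
  trans (sym (Vec.cast-is-id refl φ)) (Vec.toList-injective refl φ ψ eq)

drop-common : ∀ a {b u v : List ℕ} → a ++ u ++ b ↭ a ++ v ++ b → u ↭ v
drop-common []      {b} {u} {v} p =
  drop-prefix b (↭-trans (++-comm b u) (↭-trans p (++-comm v b)))
  where
  drop-prefix : ∀ a {u v : List ℕ} → a ++ u ↭ a ++ v → u ↭ v
  drop-prefix []      p = p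
  drop-prefix (_ ∷ a) p = drop-prefix a (drop-∷ p)
drop-common (_ ∷ a) p = drop-common a (drop-∷ p)

drop-unique : ∀ a {b u : List ℕ} → Unique (a ++ u ++ b) → Unique u
drop-unique []      {u = []}    _        = []
drop-unique []      {u = _ ∷ u} (p ∷ ps) =
  All.tabulate (λ i → All.lookup p (∈-++⁺ˡ i)) ∷ drop-unique [] ps
drop-unique (_ ∷ a) (_ ∷ ps) = drop-unique a ps

either-order : ∀ {a b} {A : Set} → a ≢ b → (a < b → A) → (b < a → A) → A
either-order {a} {b} a≢b f g with <-cmp a b
... | tri< a<b _ _ = f a<b
... | tri≈ _ a≡b _ = contradiction a≡b a≢b
... | tri> _ _ b<a = g b<a

-- A window is determined by its set of letters and their relative order: a
-- nontrivial rearrangement exchanges two of the letters or permutes all three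
-- cyclically, and either changes the relative order.
same-order⇒≡ : ∀ {u v : Vec ℕ 3} → Unique (toList u) → toList v ↭ toList u →
               (∀ i j → lookup u i < lookup u j → lookup v i < lookup v j) → u ≡ v
same-order⇒≡ {x ∷ y ∷ z ∷ []} {_ ∷ _ ∷ _ ∷ []} ((x≢y ∷ x≢z ∷ []) ∷ (y≢z ∷ []) ∷ _) p h
  with ↭⇒∈-permutationsOf (x ∷ y ∷ z ∷ []) p
... | here refl = refl
... | there (here refl) =
  contradiction (h 0F 1F) (either-order x≢y (λ l k → <-asym l (k l)) λ l _ → <-asym l (h 1F 0F l))
... | there (there (here refl)) =
  contradiction (h 0F 2F) (either-order x≢y
    (λ l k → <-asym l (k (<-trans l (h 0F 1F l))))
    (λ l _ → <-asym l (h 2F 0F (<-trans (h 1F 0F l) l))))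
... | there (there (there (here refl))) =
  contradiction (h 1F 2F) (either-order y≢z (λ l k → <-asym l (k l)) λ l _ → <-asym l (h 2F 1F l))
... | there (there (there (there (here refl)))) =
  contradiction (h 2F 1F) (either-order x≢y
    (λ l k → <-asym l (k (<-trans (h 0F 1F l) l)))
    (λ l _ → <-asym l (h 1F 2F (<-trans l (h 1F 0F l)))))
... | there (there (there (there (there (here refl))))) =
  contradiction (h 0F 2F) (either-order x≢z (λ l k → <-asym l (k l)) λ l _ → <-asym l (h 2F 0F l))

1<2 : 1 < 2
1<2 = s≤s (s≤s z≤n)

2<3 : 2 < 3
2<3 = s≤s 1<2

1<3 : 1 < 3
1<3 = <-trans 1<2 2<3

-- `parts K` lists the parts of size two; their members are the patterns whose
-- third letter is not the median.
movable-pattern : ∀ {P σ u} → P ∈ parts K → σ ∈ P → IsOrderPermutation u σ →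
                  ∀ b → Movable (toList u ++ b)
movable-pattern {u = _ ∷ _ ∷ _ ∷ []} (here refl) (here refl) (_ , h) b =
  _ , fwd (reversal (to (h 0F 1F) 1<2) (to (h 1F 2F) 2<3))
movable-pattern {u = _ ∷ _ ∷ _ ∷ []} (here refl) (there (here refl)) (_ , h) b =
  _ , bwd (reversal (to (h 2F 1F) 1<2) (to (h 1F 0F) 2<3))
movable-pattern {u = _ ∷ _ ∷ _ ∷ []} (there (here refl)) (here refl) (_ , h) b =
  _ , fwd (rotation (to (h 1F 0F) 1<2) (to (h 0F 2F) 2<3))
movable-pattern {u = _ ∷ _ ∷ _ ∷ []} (there (here refl)) (there (here refl)) (_ , h) b =
  _ , bwd (rotation (to (h 2F 0F) 1<2) (to (h 0F 1F) 2<3))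

Movable-++ : ∀ a {w} → Movable w → Movable (a ++ w)
Movable-++ []      m = m
Movable-++ (x ∷ a) m = Movable-∷ x (Movable-++ a m)

-- For permutations of at least six letters this is K-equivalence.
_≈_ : ∀ {n} → Vec ℕ n → Vec ℕ n → Set
φ ≈ ψ = φ ≡ ψ ⊎ (Movable (toList φ) × Movable (toList ψ))

≈-isEquivalence : ∀ {n} → IsEquivalence (_≈_ {n})
≈-isEquivalence = record
  { refl  = inj₁ refl
  ; sym   = Sum.map sym swap
  ; trans = λ { (inj₁ refl) q → q
              ; p (inj₁ refl) → p
              ; (inj₂ (l , _)) (inj₂ (_ , r)) → inj₂ (l , r) } }

-- Windows with equal order permutations coincide, and windows whose order
-- permutations lie in a common part of size two make both words movable.
replacement⇒≈ : ∀ {n} {φ ψ : Vec ℕ n} → Replacement K φ ψ → φ ≈ ψ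
replacement⇒≈ {φ = φ} {ψ} r with Replacement.same r
... | inj₁ refl =
  inj₁ (toList-injective (trans φ≡aub (trans (cong (λ t → a ++ toList t ++ b) u≡v) (sym ψ≡avb))))
  where
  open Replacement r
  φ-perm′ : a ++ toList u ++ b ↭ map suc (upTo _)
  φ-perm′ = subst (_↭ _) φ≡aub φ-perm
  u≡v : u ≡ v
  u≡v = same-order⇒≡ (drop-unique a (letters-unique φ-perm′))
          (↭-sym (drop-common a (↭-trans φ-perm′ (subst (_ ↭_) ψ≡avb (↭-sym ψ-perm)))))
          (λ i j → to (proj₂ v-order i j) ∘ from (proj₂ u-order i j))
... | inj₂ part with P , P∈ , σ∈ , τ∈ ← find part =
  inj₂ (subst Movable (sym φ≡aub) (Movable-++ a (movable-pattern P∈ σ∈ u-order b)) ,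
        subst Movable (sym ψ≡avb) (Movable-++ a (movable-pattern P∈ τ∈ v-order b)))
  where open Replacement r

-- a, b are distinct and ordered in the same way as a′, b′.
data SameOrder (a b a′ b′ : ℕ) : Set where
  less : a < b → a′ < b′ → SameOrder a b a′ b′
  more : b < a → b′ < a′ → SameOrder a b a′ b′

same-order : ∀ {a b c x y z} →
             SameOrder a b x y → SameOrder a c x z → SameOrder b c y z →
             ∀ i j → lookup (a ∷ b ∷ c ∷ []) i < lookup (a ∷ b ∷ c ∷ []) j ⇔
                     lookup (x ∷ y ∷ z ∷ []) i < lookup (x ∷ y ∷ z ∷ []) j
same-order p q r = λ where
    0F 0F → diagonal
    0F 1F → forth p
    0F 2F → forth q
    1F 0F → back p
    1F 1F → diagonal
    1F 2F → forth r
    2F 0F → back q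
    2F 1F → back r
    2F 2F → diagonal
  where
  diagonal : ∀ {a b} → a < a ⇔ b < b
  diagonal = mk⇔ (λ l → contradiction l (<-irrefl refl)) (λ l → contradiction l (<-irrefl refl))

  forth : ∀ {a b a′ b′} → SameOrder a b a′ b′ → a < b ⇔ a′ < b′
  forth (less l l′) = mk⇔ (λ _ → l′) (λ _ → l)
  forth (more l l′) = mk⇔ (λ k → contradiction k (<-asym l)) (λ k → contradiction k (<-asym l′))

  back : ∀ {a b a′ b′} → SameOrder a b a′ b′ → b < a ⇔ b′ < a′
  back (less l l′) = forth (more l l′)
  back (more l l′) = forth (less l l′)

part-permutation : ∀ {P σ} → P ∈ parts K → σ ∈ P → IsPermutation σ
part-permutation P∈ σ∈ = All.lookup (All.lookup (permutations K) P∈) σ∈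

-- A replacement of a window, on words not required to be permutations.
record Window (l m : List ℕ) : Set where
  field
    a b     : List ℕ
    u v     : Vec ℕ 3
    l≡aub   : l ≡ a ++ toList u ++ b
    m≡avb   : m ≡ a ++ toList v ++ b
    σ τ     : Vec ℕ 3
    u-order : IsOrderPermutation u σ
    v-order : IsOrderPermutation v τ
    same    : SamePart K σ τ

⇝⇒window : ∀ {l m} → l ⇝ m → Window l m
⇝⇒window {x ∷ y ∷ z ∷ w} (reversal x<y y<z) = record
  { a = [] ; b = w ; u = x ∷ y ∷ z ∷ [] ; v = z ∷ y ∷ x ∷ [] ; l≡aub = refl ; m≡avb = refl
  ; u-order = part-permutation (here refl) (here refl) ,
              same-order (less 1<2 x<y) (less 1<3 x<z) (less 2<3 y<z)
  ; v-order = part-permutation (here refl) (there (here refl)) ,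
              same-order (more 2<3 y<z) (more 1<3 x<z) (more 1<2 x<y)
  ; same    = inj₂ (here (here refl , there (here refl))) }
  where
  x<z = <-trans x<y y<z
⇝⇒window {y ∷ x ∷ z ∷ w} (rotation x<y y<z) = record
  { a = [] ; b = w ; u = y ∷ x ∷ z ∷ [] ; v = y ∷ z ∷ x ∷ [] ; l≡aub = refl ; m≡avb = refl
  ; u-order = part-permutation (there (here refl)) (here refl) ,
              same-order (more 1<2 x<y) (less 2<3 y<z) (less 1<3 x<z)
  ; v-order = part-permutation (there (here refl)) (there (here refl)) ,
              same-order (less 2<3 y<z) (more 1<2 x<y) (more 1<3 x<z)
  ; same    = inj₂ (there (here (here refl , there (here refl)))) }
  where
  x<z = <-trans x<y y<z
⇝⇒window (skip {x} s) = record
  { a = x ∷ a ; b = b ; u = u ; v = v ; l≡aub = cong (x ∷_) l≡aub ; m≡avb = cong (x ∷_) m≡avb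
  ; u-order = u-order ; v-order = v-order ; same = same }
  where open Window (⇝⇒window s)

⇝⇒replacement : ∀ {n} {φ ψ : Vec ℕ n} → IsPermutation φ → IsPermutation ψ →
                toList φ ⇝ toList ψ → Replacement K φ ψ
⇝⇒replacement p q s = record
  { φ-perm = p ; ψ-perm = q ; a = a ; b = b ; u = u ; v = v ; φ≡aub = l≡aub ; ψ≡avb = m≡avb
  ; σ = σ ; τ = τ ; u-order = u-order ; v-order = v-order ; same = same }
  where open Window (⇝⇒window s)

list⇒vec : ∀ {n} l → length l ≡ n → ∃ λ (φ : Vec ℕ n) → toList φ ≡ l
list⇒vec l refl = fromList l , Vec.toList∘fromList l

-- Every word on a chain of moves that starts at a permutation in S n is again
-- one, so the chain lifts to a chain of replacements.
∼⇒equivalent : ∀ {n} {φ ψ : Vec ℕ n} → IsPermutation φ → toList φ ∼ toList ψ →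
               EqClosure (Replacement K) φ ψ
∼⇒equivalent {n} {ψ = ψ} p s = lift p s refl
  where
  lift : ∀ {φ l} → IsPermutation φ → toList φ ∼ l → l ≡ toList ψ → EqClosure (Replacement K) φ ψ
  lift p ε eq = subst (EqClosure _ _) (toList-injective eq) ε
  lift {φ} p (_◅_ {j = m} s ss) eq
    with m↭ ← ∼⇒↭ (s ◅ ε)
    with χ , refl ← list⇒vec m (trans (sym (↭-length m↭)) (Vec.length-toList φ)) =
    step s ◅ lift q ss eq
    where
    q : IsPermutation χ
    q = ↭-trans (↭-sym m↭) p
    step : toList φ ⇌ toList χ → Sym.SymClosure (Replacement K) φ χ
    step (fwd t) = fwd (⇝⇒replacement p q t)
    step (bwd t) = bwd (⇝⇒replacement q p t)

-- The three classes

-- The kinds of words, one for each class.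
Kind : Fin 3 → List ℕ → Set
Kind 0F = Low
Kind 1F = High
Kind 2F = Movable

kind : ∀ {w} → Unique w → ∃ λ i → Kind i w
kind uw with classify uw
... | inj₁ l        = 0F , l
... | inj₂ (inj₁ h) = 1F , h
... | inj₂ (inj₂ m) = 2F , m

kind-unique : ∀ {x y w} i j → Kind i (x ∷ y ∷ w) → Kind j (x ∷ y ∷ w) → i ≡ j
kind-unique 0F 0F _ _ = refl
kind-unique 0F 1F ((x<y ∷ _) ∷ _) ((x>y ∷ _) ∷ _) = contradiction x<y (<-asym x>y)
kind-unique 0F 2F l m = contradiction m (low-immovable l)
kind-unique 1F 0F ((x>y ∷ _) ∷ _) ((x<y ∷ _) ∷ _) = contradiction x<y (<-asym x>y)
kind-unique 1F 1F _ _ = refl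
kind-unique 1F 2F h m = contradiction m (high-immovable h)
kind-unique 2F 0F m l = contradiction m (low-immovable l)
kind-unique 2F 1F m h = contradiction m (high-immovable h)
kind-unique 2F 2F _ _ = refl

kind-resp-≈ : ∀ {n} i {φ ψ : Vec ℕ n} → φ ≈ ψ → Kind i (toList φ) → Kind i (toList ψ)
kind-resp-≈ i  (inj₁ refl)    p = p
kind-resp-≈ 0F (inj₂ (m , _)) l = contradiction m (low-immovable l)
kind-resp-≈ 1F (inj₂ (m , _)) h = contradiction m (high-immovable h)
kind-resp-≈ 2F (inj₂ (_ , m)) _ = m

kind-complete : ∀ k i {φ ψ : Vec ℕ (6 + k)} → IsPermutation φ → IsPermutation ψ →
                Kind i (toList φ) → Kind i (toList ψ) → EqClosure (Replacement K) φ ψ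
kind-complete k i {φ} {ψ} p q c d = ∼⇒equivalent p (complete i c d)
  where
  φ↭ψ : toList φ ↭ toList ψ
  φ↭ψ = ↭-trans p (↭-sym q)

  ≡⇒∼ : ∀ {u v} → u ≡ v → u ∼ v
  ≡⇒∼ refl = ε

  complete : ∀ i → Kind i (toList φ) → Kind i (toList ψ) → toList φ ∼ toList ψ
  complete 0F l l′ = ≡⇒∼ (spiral-unique <-asym <-asym l l′ φ↭ψ)
  complete 1F h h′ = ≡⇒∼ (spiral-unique <-asym <-asym h h′ φ↭ψ)
  complete 2F m m′ = movable-connected k (Vec.length-toList φ) (letters-unique p) φ↭ψ m m′

list-of-kind : ∀ k i → ∃ λ l → l ↭ interval 1 (3 + k) × Kind i l
list-of-kind k 0F = low  1 (3 + k) , low-↭  1 (3 + k) , low-spiral  1 (3 + k)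
list-of-kind k 1F = high 1 (3 + k) , high-↭ 1 (3 + k) , high-spiral 1 (3 + k)
list-of-kind k 2F = interval 1 (3 + k) , ↭-refl , _ , fwd (reversal 1<2 2<3)

interval≡letters : ∀ n → interval 1 n ≡ map suc (upTo n)
interval≡letters n = sym (trans (map-upTo suc n) (interval≡applyUpTo (λ _ → refl) n))

letters-length : ∀ n → length (map suc (upTo n)) ≡ n
letters-length n = trans (length-map suc (upTo n)) (length-upTo n)

representative : ∀ k i → ∃ λ (φ : S (3 + k)) → Kind i (toList (word φ))
representative k i
  with l , l↭ , c ← list-of-kind k i
  with p ← subst (l ↭_) (interval≡letters (3 + k)) l↭
  with φ , refl ← list⇒vec l (trans (↭-length p) (letters-length (3 + k))) =
  perm φ p , c

proposition3p88 : (n : ℕ) → n > 5 → HasExactlyClasses (equivalence K n) 3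
proposition3p88 _ (s≤s (s≤s (s≤s (s≤s (s≤s (s≤s (z≤n {k}))))))) = record
  { to        = rep
  ; cong      = λ { refl → ε }
  ; bijective = (λ {i} {j} → injective i j) , surjective
  }
  where
  rep : Fin 3 → S (6 + k)
  rep i = proj₁ (representative (3 + k) i)

  rep-kind : ∀ i → Kind i (toList (word (rep i)))
  rep-kind i = proj₂ (representative (3 + k) i)

  unique : ∀ {i j} (φ : Vec ℕ (6 + k)) → Kind i (toList φ) → Kind j (toList φ) → i ≡ j
  unique (_ ∷ _ ∷ _) = kind-unique _ _

  injective : ∀ i j → EqClosure (Replacement K) (word (rep i)) (word (rep j)) → i ≡ j
  injective i j e = unique (word (rep j))
    (kind-resp-≈ i (EqC.fold ≈-isEquivalence replacement⇒≈ e) (rep-kind i)) (rep-kind j)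

  surjective : ∀ (φ : S (6 + k)) → ∃ λ i → ∀ {j} → j ≡ i →
               EqClosure (Replacement K) (word (rep j)) (word φ)
  surjective (perm φ p) with i , c ← kind (letters-unique p) =
    i , λ { refl → kind-complete k i (isPermutation (rep i)) p (rep-kind i) c }
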